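{- Let $C$ be an extended linear code of length $d+1$ over $\mathbb{Z}_N$ and let $g=(g_{ji})$ be a generating matrix of $C$, with $m$ rows and with columns indexed by $i=0,\dots,d$. Put $\gcd_i=\gcd(g_{1i},\dots,g_{mi},N)$. If the linear code $C$ is thin, then $$\sum_{i=0}^d \gcd\nolimits_i>N.$$
   Context: $\mathbb{Z}_N=\mathbb{Z}/N\mathbb{Z}$; its elements are identified with the representatives $0,1,\dots,N-1$, and gcd's are taken of these integers. A linear code of length $n$ over $\mathbb{Z}_N$ is a submodule $C\subseteq\mathbb{Z}_N^n$; its elements are called words; a generating matrix is a matrix whose rows generate $C$. $C$ is extended if every word has coordinate sum $0\bmod N$. An extended code is thin if it contains no word of maximal weight, i.e. no word all of whose entries are nonzero.
   Formalization: The formal statement assumes d ≥ 1: for d = 0 an extended code of length 1 is {0}, which is thin, yet gcd_0 = N, so the sum equals N and the strict inequality fails. -}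

module Defs where

open import Data.Fin using (Fin; toℕ)
open import Data.Nat using (ℕ; NonZero; _+_; _*_)
open import Data.Nat.DivMod using (_mod_)
open import Data.Nat.GCD using (gcd)
open import Data.Product using (∃-syntax; _×_)
open import Data.Vec using (Vec; foldr′; lookup; map; replicate; zipWith)
open import Data.Vec.Relation.Unary.All using (All)
open import Function.Bundles using (_⇔_)
open import Level using (Level; suc)
open import Relation.Binary.PropositionalEquality using (_≡_; _≢_)
open import Relation.Nullary using (¬_)
open import Relation.Unary using (Pred; _∈_)

-- ℤ/Nℤ, each class being identified with its representative in {0, …, N-1}.
ℤ/ : ℕ → Set
ℤ/ N = Fin N

module _ {N : ℕ} .{{_ : NonZero N}} where

  infixl 6 _⊕_ _+ᵥ_
  infixl 7 _⊗_ _*ᵥ_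

  𝟘 : ℤ/ N
  𝟘 = 0 mod N

  _⊕_ : ℤ/ N → ℤ/ N → ℤ/ N
  x ⊕ y = (toℕ x + toℕ y) mod N

  _⊗_ : ℤ/ N → ℤ/ N → ℤ/ N
  x ⊗ y = (toℕ x * toℕ y) mod N

  0ᵥ : ∀ {n} → Vec (ℤ/ N) n
  0ᵥ {n} = replicate n 𝟘

  _+ᵥ_ : ∀ {n} → Vec (ℤ/ N) n → Vec (ℤ/ N) n → Vec (ℤ/ N) n
  _+ᵥ_ = zipWith _⊕_

  _*ᵥ_ : ∀ {n} → ℤ/ N → Vec (ℤ/ N) n → Vec (ℤ/ N) n
  c *ᵥ v = map (c ⊗_) v

  coordinateSum : ∀ {n} → Vec (ℤ/ N) n → ℤ/ N
  coordinateSum = foldr′ _⊕_ 𝟘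

  linearCombination : ∀ {m n} → Vec (ℤ/ N) m → Vec (Vec (ℤ/ N) n) m → Vec (ℤ/ N) n
  linearCombination a g = foldr′ _+ᵥ_ 0ᵥ (zipWith _*ᵥ_ a g)

-- Closure under negation is automatic, since -w = (N-1)·w.
record LinearCode (ℓ : Level) (N : ℕ) .{{_ : NonZero N}} (n : ℕ) : Set (suc ℓ) where
  field
    Word      : Pred (Vec (ℤ/ N) n) ℓ
    0-closed  : 0ᵥ ∈ Word
    +-closed  : ∀ {v w} → v ∈ Word → w ∈ Word → v +ᵥ w ∈ Word
    *-closed  : ∀ c {w} → w ∈ Word → c *ᵥ w ∈ Word

open LinearCode public using (Word)

module _ {ℓ : Level} {N : ℕ} .{{_ : NonZero N}} {n : ℕ} where

  IsGeneratingMatrix : ∀ {m} → Vec (Vec (ℤ/ N) n) m → LinearCode ℓ N n → Set ℓ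
  IsGeneratingMatrix {m} g C =
    ∀ w → w ∈ Word C ⇔ (∃[ a ] w ≡ linearCombination {m = m} a g)

  Extended : LinearCode ℓ N n → Set ℓ
  Extended C = ∀ w → w ∈ Word C → coordinateSum w ≡ 𝟘

  Thin : LinearCode ℓ N n → Set ℓ
  Thin C = ¬ (∃[ w ] w ∈ Word C × All (_≢ 𝟘) w)

-- gcd (g₁ᵢ, …, gₘᵢ, N), a natural number; it equals N when m = 0.
columnGcd : ∀ {N m n} → Vec (Vec (ℤ/ N) n) m → Fin n → ℕ
columnGcd {N} g i = foldr′ gcd N (map (λ row → toℕ (lookup row i)) g)

{-# OPTIONS --safe #-}
-- Count coefficient vectors a ∈ (ℤ/N)ᵐ.  The i-th coordinate of a·g vanishes for
-- at most a fraction gcdᵢ / N of them.  If C is thin, each a·g has a vanishing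
-- coordinate, and a = 0 has d + 1 ≥ 2 of them; so counting the pairs (a , i) with
-- (a·g)ᵢ = 0 in two ways gives  N · (Nᵐ + 1) ≤ (Σ gcdᵢ) · Nᵐ.
module Submission where

open import Defs
open import Data.Fin using (Fin; zero; suc; toℕ)
open import Data.Fin.Properties using (toℕ<n; toℕ-fromℕ<)
open import Data.Nat using (ℕ; zero; suc; NonZero; _+_; _*_; _^_; _≤_; _<_; _>_; z≤n; s≤s; _≤?_; ≢-nonZero; ≢-nonZero⁻¹)
open import Data.Nat.DivMod using (_%_; _mod_; m%n<n; %-distribˡ-+; m%n≤m)
open import Data.Nat.Divisibility using (_∣_; _∣?_; divides; ∣-refl; ∣-trans; ∣⇒≤; _∣0; n∣m*n; ∣n⇒∣m*n; ∣m+n∣m⇒∣n; *-cancelʳ-∣; m%n≡0⇒n∣m)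
open import Data.Nat.GCD using (gcd; gcd-greatest; gcd[m,n]∣m; gcd[m,n]∣n; gcd[m,n]≢0; c*gcd[m,n]≡gcd[cm,cn])
open import Data.Nat.Properties
open import Data.Nat.Tactic.RingSolver using (solve-∀)
open import Data.Product using (_,_)
open import Data.Sum using (inj₂)
open import Data.Vec using (Vec; []; _∷_; foldr′; lookup; map; replicate; sum; tabulate)
open import Data.Vec.Properties using (lookup-map; lookup-replicate; lookup-zipWith)
open import Data.Vec.Relation.Unary.All.Properties using (lookup⁻)
open import Function using (_∘_)
open import Function.Bundles using (Equivalence)
open import Level using (Level)
open import Relation.Binary.PropositionalEquality using (_≡_; _≢_; refl; sym; trans; cong; cong₂; subst; module ≡-Reasoning)
open import Relation.Nullary using (¬_; Dec; yes; no; contradiction)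
open import Relation.Unary using (Pred; Decidable)

open import Algebra.Properties.Semiring.Sum +-*-semiring
  using (sum-syntax; sum-cong-≗; ∑-comm; *-distribˡ-sum; *-distribʳ-sum)

private
  variable
    p : Level
    m n : ℕ

𝟙 : {P : Set p} → Dec P → ℕ
𝟙 (yes _) = 1
𝟙 (no _)  = 0

𝟙-yes : {P : Set p} (P? : Dec P) → P → 𝟙 P? ≡ 1
𝟙-yes (yes _) _ = refl
𝟙-yes (no ¬x) x = contradiction x ¬x

𝟙-no : {P : Set p} (P? : Dec P) → ¬ P → 𝟙 P? ≡ 0
𝟙-no (yes x) ¬x = contradiction x ¬x
𝟙-no (no _)  _  = refl

∑-mono-≤ : {f g : Fin n → ℕ} → (∀ i → f i ≤ g i) → ∑[ i < n ] f i ≤ ∑[ i < n ] g i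
∑-mono-≤ {zero}  f≤g = z≤n
∑-mono-≤ {suc n} f≤g = +-mono-≤ (f≤g zero) (∑-mono-≤ (f≤g ∘ suc))

∑-mono-< : {f g : Fin n → ℕ} → (∀ i → f i ≤ g i) → ∀ j → f j < g j →
           ∑[ i < n ] f i < ∑[ i < n ] g i
∑-mono-< f≤g zero    fj<gj = +-mono-<-≤ fj<gj (∑-mono-≤ (f≤g ∘ suc))
∑-mono-< f≤g (suc j) fj<gj = +-mono-≤-< (f≤g zero) (∑-mono-< (f≤g ∘ suc) j fj<gj)

∑-const : ∀ n c → ∑[ i < n ] c ≡ n * c
∑-const zero    c = refl
∑-const (suc n) c = cong (c +_) (∑-const n c)

∑≡0 : {f : Fin n → ℕ} → (∀ i → f i ≡ 0) → ∑[ i < n ] f i ≡ 0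
∑≡0 {n} f≡0 = trans (sum-cong-≗ f≡0) (trans (∑-const n 0) (*-zeroʳ n))

≤∑ : (f : Fin n → ℕ) → ∀ j → f j ≤ ∑[ i < n ] f i
≤∑ f zero    = m≤m+n _ _
≤∑ f (suc j) = ≤-trans (≤∑ (f ∘ suc) j) (m≤n+m _ _)

-- Taking `f` on ℕ rather than on `Fin (m + n)` makes the second block a plain shift, with no
-- injections of `Fin`.
∑-split : ∀ m {n} (f : ℕ → ℕ) →
          ∑[ i < m + n ] f (toℕ i) ≡ ∑[ i < m ] f (toℕ i) + ∑[ i < n ] f (m + toℕ i)
∑-split zero    f = refl
∑-split (suc m) f = trans (cong (f 0 +_) (∑-split m (f ∘ suc))) (sym (+-assoc (f 0) _ _))

sum-tabulate : (f : Fin n → ℕ) → sum (tabulate f) ≡ ∑[ i < n ] f i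
sum-tabulate {zero}  f = refl
sum-tabulate {suc n} f = cong (f zero +_) (sum-tabulate (f ∘ suc))

-- Solutions of one linear congruence

Spaced : ℕ → Pred ℕ p → Set p
Spaced q P = ∀ x k → P x → P (x + k) → q ∣ k

module _ {q : ℕ} where

  -- `Spaced` confines `P` to one residue class modulo `q` without asking for the whole class; this
  -- is enough for upper bounds.
  count-window : {P : Pred ℕ p} (P? : Decidable P) → Spaced q P →
                 ∀ n → n ≤ q → ∑[ i < n ] 𝟙 (P? (toℕ i)) ≤ 1
  count-window P? spaced zero    n≤q = z≤n
  count-window P? spaced (suc n) n<q with P? 0
  ... | no _   = count-window (P? ∘ suc) (spaced ∘ suc) n (<⇒≤ n<q)
  -- A further solution would lie at a distance `suc (toℕ i)` from 0, which is positive and below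
  -- `q`, hence no multiple of `q`.
  ... | yes P0 = ≤-reflexive (cong suc (∑≡0 λ i → 𝟙-no (P? _) λ Pi →
    <⇒≱ (≤-<-trans (toℕ<n i) n<q) (∣⇒≤ (spaced 0 _ P0 Pi))))

  count-windows : {P : Pred ℕ p} (P? : Decidable P) → Spaced q P →
                  ∀ r → ∑[ i < r * q ] 𝟙 (P? (toℕ i)) ≤ r
  count-windows P? spaced zero    = z≤n
  count-windows {P = P} P? spaced (suc r) = begin
    ∑[ i < q + r * q ] 𝟙 (P? (toℕ i))
      ≡⟨ ∑-split q (𝟙 ∘ P?) ⟩
    ∑[ i < q ] 𝟙 (P? (toℕ i)) + ∑[ i < r * q ] 𝟙 (P? (q + toℕ i))
      ≤⟨ +-mono-≤ (count-window P? spaced q ≤-refl) (count-windows (P? ∘ (q +_)) shifted r) ⟩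
    1 + r ∎
    where
    open ≤-Reasoning
    shifted : Spaced q (P ∘ (q +_))
    shifted x k Px Py = spaced (q + x) k Px (subst P (sym (+-assoc q x k)) Py)

gcd-nonZero : ∀ g e .{{_ : NonZero e}} → NonZero (gcd g e)
gcd-nonZero g e = ≢-nonZero (gcd[m,n]≢0 g e (inj₂ (≢-nonZero⁻¹ e)))

-- Two solutions differ by a multiple of e / gcd g e.
count-solutions : ∀ {N e} .{{_ : NonZero e}} → e ∣ N → ∀ g t →
  e * ∑[ x < N ] 𝟙 (e ∣? toℕ x * g + t) ≤ 𝟙 (gcd g e ∣? t) * (gcd g e * N)
count-solutions {N} {e} e∣N g t with gcd g e ∣? t | e∣N | gcd[m,n]∣n g e
... | no h∤t | _ | _ = ≤-reflexive (trans (cong (e *_) (∑≡0 {N} λ x → 𝟙-no (e ∣? _) (unsolvable (toℕ x)))) (*-zeroʳ e))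
  where
  unsolvable : ∀ x → ¬ e ∣ x * g + t
  -- `gcd g e` divides `x * g` and, through `e`, the whole sum, so it would divide `t`.
  unsolvable x e∣ = h∤t (∣m+n∣m⇒∣n (∣-trans (gcd[m,n]∣n g e) e∣) (∣n⇒∣m*n x (gcd[m,n]∣m g e)))
... | yes _ | divides k N≡ke | divides q e≡qh = begin
  e * ∑[ x < N ] 𝟙 (e ∣? toℕ x * g + t)
    ≡⟨ cong (λ M → e * ∑[ x < M ] 𝟙 (e ∣? toℕ x * g + t)) N≡khq ⟩
  e * ∑[ x < k * h * q ] 𝟙 (e ∣? toℕ x * g + t)
    ≤⟨ *-monoʳ-≤ e (count-windows (λ x → e ∣? x * g + t) spaced (k * h)) ⟩
  e * (k * h)
    ≡⟨ rearrange₁ e k h ⟩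
  1 * (h * (k * e))
    ≡⟨ cong (λ M → 1 * (h * M)) N≡ke ⟨
  1 * (h * N) ∎
  where
  open ≤-Reasoning
  h = gcd g e
  instance
    h≢0 : NonZero h
    h≢0 = gcd-nonZero g e
  rearrange₁ : ∀ e k h → e * (k * h) ≡ 1 * (h * (k * e))
  rearrange₁ = solve-∀
  rearrange₂ : ∀ q k h → k * (q * h) ≡ k * h * q
  rearrange₂ = solve-∀
  rearrange₃ : ∀ x k g t → (x + k) * g + t ≡ (x * g + t) + k * g
  rearrange₃ = solve-∀
  -- The range below `N` is cut into `k * h` windows of length `q`, the quotient of `e` by `h`.
  N≡khq : N ≡ k * h * q
  N≡khq = trans N≡ke (trans (cong (k *_) e≡qh) (rearrange₂ q k h))
  spaced : Spaced q (λ x → e ∣ x * g + t)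
  -- Subtracting the two solutions gives that `e` divides `j * g`. It also divides `j * e`, hence
  -- their gcd `j * h`; as `e` is `q * h`, the factor `h` cancels.
  spaced x j e∣x e∣x+j = *-cancelʳ-∣ h
    (subst (_∣ j * h) e≡qh (subst (e ∣_) (sym (c*gcd[m,n]≡gcd[cm,cn] j g e))
      (gcd-greatest (∣m+n∣m⇒∣n (subst (e ∣_) (rearrange₃ x j g t) e∣x+j) e∣x) (n∣m*n j))))

-- Sums over coefficient vectors

module _ {N : ℕ} where

  ∑ᵛ : ∀ m → (Vec (Fin N) m → ℕ) → ℕ
  ∑ᵛ zero    f = f []
  ∑ᵛ (suc m) f = ∑[ x < N ] ∑ᵛ m (λ a → f (x ∷ a))

  ∑ᵛ-cong : {f g : Vec (Fin N) m → ℕ} → (∀ a → f a ≡ g a) → ∑ᵛ m f ≡ ∑ᵛ m g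
  ∑ᵛ-cong {zero}  f≡g = f≡g []
  ∑ᵛ-cong {suc m} f≡g = sum-cong-≗ λ x → ∑ᵛ-cong (f≡g ∘ (x ∷_))

  ∑ᵛ-mono-≤ : {f g : Vec (Fin N) m → ℕ} → (∀ a → f a ≤ g a) → ∑ᵛ m f ≤ ∑ᵛ m g
  ∑ᵛ-mono-≤ {zero}  f≤g = f≤g []
  ∑ᵛ-mono-≤ {suc m} f≤g = ∑-mono-≤ λ x → ∑ᵛ-mono-≤ (f≤g ∘ (x ∷_))

  ∑ᵛ-mono-< : {f g : Vec (Fin N) m → ℕ} → (∀ a → f a ≤ g a) → ∀ b → f b < g b →
              ∑ᵛ m f < ∑ᵛ m g
  ∑ᵛ-mono-< f≤g []      fb<gb = fb<gb
  ∑ᵛ-mono-< f≤g (x ∷ b) fb<gb =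
    ∑-mono-< (λ y → ∑ᵛ-mono-≤ (f≤g ∘ (y ∷_))) x (∑ᵛ-mono-< (f≤g ∘ (x ∷_)) b fb<gb)

  ∑ᵛ-one : ∀ m → ∑ᵛ m (λ _ → 1) ≡ N ^ m
  ∑ᵛ-one zero    = refl
  ∑ᵛ-one (suc m) = trans (sum-cong-≗ {N} λ _ → ∑ᵛ-one m) (∑-const N (N ^ m))

  ∑ᵛ-∑-comm : ∀ m (f : Vec (Fin N) m → Fin n → ℕ) →
              ∑ᵛ m (λ a → ∑[ i < n ] f a i) ≡ ∑[ i < n ] ∑ᵛ m (λ a → f a i)
  ∑ᵛ-∑-comm zero    f = refl
  ∑ᵛ-∑-comm (suc m) f =
    trans (sum-cong-≗ λ x → ∑ᵛ-∑-comm m (f ∘ (x ∷_))) (∑-comm λ x i → ∑ᵛ m (λ a → f (x ∷ a) i))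

  -- The value stays unreduced in ℕ, so that vanishing modulo `N` becomes divisibility by `N`.
  dot : Vec (Fin N) m → Vec ℕ m → ℕ
  dot []      []      = 0
  dot (x ∷ a) (y ∷ c) = toℕ x * y + dot a c

-- Zeros of a linear form modulo `N`

module _ {N : ℕ} .{{_ : NonZero N}} where

  gcds-nonZero : (c : Vec ℕ m) → NonZero (foldr′ gcd N c)
  gcds-nonZero []      = ≢-nonZero (≢-nonZero⁻¹ N)
  gcds-nonZero (y ∷ c) = gcd-nonZero y _ {{gcds-nonZero c}}

  gcds∣N : (c : Vec ℕ m) → foldr′ gcd N c ∣ N
  gcds∣N []      = ∣-refl
  gcds∣N (y ∷ c) = ∣-trans (gcd[m,n]∣n y _) (gcds∣N c)

  -- The inhomogeneous term t, with the factor 𝟙, is what makes the induction on m work.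
  count-affine-zeros : (c : Vec ℕ m) → ∀ t →
    N * ∑ᵛ {N} m (λ a → 𝟙 (N ∣? dot a c + t)) ≤
    𝟙 (foldr′ gcd N c ∣? t) * (foldr′ gcd N c * N ^ m)
  count-affine-zeros [] t = ≤-reflexive (trans (*-comm N _) (cong (𝟙 (N ∣? t) *_) (sym (*-identityʳ N))))
  count-affine-zeros {suc m} (y ∷ c) t = begin
    N * ∑[ x < N ] ∑ᵛ m (λ a → 𝟙 (N ∣? dot (x ∷ a) (y ∷ c) + t))
      ≡⟨ cong (N *_) (sum-cong-≗ {N} λ x → ∑ᵛ-cong λ a →
           cong (λ s → 𝟙 (N ∣? s)) (rearrange₁ (toℕ x * y) (dot a c) t)) ⟩
    N * ∑[ x < N ] ∑ᵛ m (λ a → 𝟙 (N ∣? dot a c + (toℕ x * y + t)))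
      ≡⟨ *-distribˡ-sum {N} N _ ⟩
    ∑[ x < N ] (N * ∑ᵛ m (λ a → 𝟙 (N ∣? dot a c + (toℕ x * y + t))))
      -- With `x` fixed, `toℕ x * y` is part of the inhomogeneous term.
      ≤⟨ ∑-mono-≤ {N} (λ x → count-affine-zeros c (toℕ x * y + t)) ⟩
    ∑[ x < N ] (𝟙 (e ∣? toℕ x * y + t) * (e * N ^ m))
      ≡⟨ *-distribʳ-sum {N} (e * N ^ m) _ ⟨
    ∑[ x < N ] 𝟙 (e ∣? toℕ x * y + t) * (e * N ^ m)
      ≡⟨ rearrange₂ (∑[ x < N ] 𝟙 (e ∣? toℕ x * y + t)) e (N ^ m) ⟩
    e * ∑[ x < N ] 𝟙 (e ∣? toℕ x * y + t) * N ^ m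
      -- What remains is a single congruence in `x` modulo `e`, a divisor of `N`.
      ≤⟨ *-monoˡ-≤ (N ^ m) (count-solutions {{gcds-nonZero c}} (gcds∣N c) y t) ⟩
    𝟙 (gcd y e ∣? t) * (gcd y e * N) * N ^ m
      ≡⟨ rearrange₃ (𝟙 (gcd y e ∣? t)) (gcd y e) N (N ^ m) ⟩
    𝟙 (gcd y e ∣? t) * (gcd y e * (N * N ^ m)) ∎
    where
    open ≤-Reasoning
    e = foldr′ gcd N c
    rearrange₁ : ∀ u v t → u + v + t ≡ v + (u + t)
    rearrange₁ = solve-∀
    rearrange₂ : ∀ u e w → u * (e * w) ≡ e * u * w
    rearrange₂ = solve-∀
    rearrange₃ : ∀ u h N w → u * (h * N) * w ≡ u * (h * (N * w))
    rearrange₃ = solve-∀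

  -- The homogeneous case: everything divides 0, so the indicator on the right is 1.
  count-zeros : (c : Vec ℕ m) →
    N * ∑ᵛ {N} m (λ a → 𝟙 (N ∣? dot a c)) ≤ foldr′ gcd N c * N ^ m
  count-zeros {m} c = begin
    N * ∑ᵛ m (λ a → 𝟙 (N ∣? dot a c))
      ≡⟨ cong (N *_) (∑ᵛ-cong λ a → cong (λ s → 𝟙 (N ∣? s)) (sym (+-identityʳ (dot a c)))) ⟩
    N * ∑ᵛ m (λ a → 𝟙 (N ∣? dot a c + 0))
      ≤⟨ count-affine-zeros c 0 ⟩
    𝟙 (e ∣? 0) * (e * N ^ m)
      ≡⟨ cong (_* (e * N ^ m)) (𝟙-yes (e ∣? 0) (e ∣0)) ⟩
    1 * (e * N ^ m)
      ≡⟨ *-identityˡ _ ⟩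
    e * N ^ m ∎
    where
    open ≤-Reasoning
    e = foldr′ gcd N c

  -- Coordinates of words

  toℕ-mod : ∀ k → toℕ (k mod N) ≡ k % N
  toℕ-mod k = toℕ-fromℕ< (m%n<n k N)

  toℕ-𝟘 : toℕ (𝟘 {N}) ≡ 0
  toℕ-𝟘 = n≤0⇒n≡0 (≤-trans (≤-reflexive (toℕ-mod 0)) (m%n≤m 0 N))

  -- Written so that `foldr′ gcd N (column g i)` is `columnGcd g i` by definition.
  column : Vec (Vec (ℤ/ N) n) m → Fin n → Vec ℕ m
  column g i = map (λ row → toℕ (lookup row i)) g

  lookup-linearCombination : (a : Vec (ℤ/ N) m) (g : Vec (Vec (ℤ/ N) n) m) → ∀ i →
    toℕ (lookup (linearCombination a g) i) ≡ dot a (column g i) % N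
  lookup-linearCombination [] [] i = trans (cong toℕ (lookup-replicate i 𝟘)) (toℕ-mod 0)
  lookup-linearCombination (x ∷ a) (row ∷ g) i = begin
    toℕ (lookup ((x *ᵥ row) +ᵥ w) i)
      ≡⟨ cong toℕ (lookup-zipWith _⊕_ i (x *ᵥ row) w) ⟩
    toℕ (lookup (x *ᵥ row) i ⊕ lookup w i)
      ≡⟨ toℕ-mod _ ⟩
    (toℕ (lookup (x *ᵥ row) i) + toℕ (lookup w i)) % N
      ≡⟨ cong (_% N) (cong₂ _+_ (trans (cong toℕ (lookup-map i (x ⊗_) row)) (toℕ-mod _)) (lookup-linearCombination a g i)) ⟩
    ((toℕ x * toℕ (lookup row i)) % N + dot a (column g i) % N) % N
      ≡⟨ %-distribˡ-+ (toℕ x * toℕ (lookup row i)) (dot a (column g i)) N ⟨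
    (toℕ x * toℕ (lookup row i) + dot a (column g i)) % N ∎
    where
    open ≡-Reasoning
    w = linearCombination a g

  dot-zeroˡ : (c : Vec ℕ m) → dot (replicate m 𝟘) c ≡ 0
  dot-zeroˡ []      = refl
  dot-zeroˡ (y ∷ c) = cong₂ _+_ (cong (_* y) toℕ-𝟘) (dot-zeroˡ c)

  zeros : Vec (Vec (ℤ/ N) n) m → Vec (ℤ/ N) m → ℕ
  zeros {n} g a = ∑[ i < n ] 𝟙 (N ∣? dot a (column g i))

  zeros-zero : (g : Vec (Vec (ℤ/ N) n) m) → zeros g (replicate m 𝟘) ≡ n
  zeros-zero {n} g = trans
    (sum-cong-≗ λ i → 𝟙-yes (N ∣? _) (subst (N ∣_) (sym (dot-zeroˡ (column g i))) (N ∣0)))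
    (trans (∑-const n 1) (*-identityʳ n))

  -- Otherwise `linearCombination a g` would be a word of maximal weight. Since `1 ≤ zeros g a` is
  -- decidable, the negative hypothesis `Thin C` yields a positive count.
  thin⇒zeros : ∀ {ℓ} (C : LinearCode ℓ N n) (g : Vec (Vec (ℤ/ N) n) m) →
    IsGeneratingMatrix g C → Thin C → ∀ a → 1 ≤ zeros g a
  thin⇒zeros C g gen thin a with 1 ≤? zeros g a
  ... | yes 1≤ = 1≤
  ... | no  1≰ = contradiction
    (w , Equivalence.from (gen w) (a , refl) , lookup⁻ nonzero) thin
    where
    w = linearCombination a g
    nonzero : ∀ i → lookup w i ≢ 𝟘
    -- A vanishing coordinate `i` would contribute a summand 1 to `zeros g a`.
    nonzero i wᵢ≡𝟘 = 1≰ (subst (_≤ zeros g a) (𝟙-yes (N ∣? _) N∣dot) (≤∑ _ i))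
      where
      N∣dot : N ∣ dot a (column g i)
      N∣dot = m%n≡0⇒n∣m _ N
        (trans (sym (lookup-linearCombination a g i)) (trans (cong toℕ wᵢ≡𝟘) toℕ-𝟘))

proposition2p12 : ∀ {ℓ : Level} (N : ℕ) .{{_ : NonZero N}} (d : ℕ) → 1 ≤ d →
    (C : LinearCode ℓ N (suc d)) → Extended C →
    (m : ℕ) (g : Vec (Vec (ℤ/ N) (suc d)) m) → IsGeneratingMatrix g C →
    Thin C → sum (tabulate (columnGcd g)) > N
proposition2p12 N d 1≤d C _ m g gen thin = *-cancelʳ-< _ _ _ (begin-strict
  N * N ^ m
    <⟨ *-monoʳ-< N N^m<zeros ⟩
  N * ∑ᵛ m (zeros g)
    ≡⟨ cong (N *_) (∑ᵛ-∑-comm m (λ a i → 𝟙 (N ∣? dot a (column g i)))) ⟩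
  N * ∑[ i < suc d ] colZeros i
    ≡⟨ *-distribˡ-sum N colZeros ⟩
  ∑[ i < suc d ] (N * colZeros i)
    ≤⟨ ∑-mono-≤ {suc d} (λ i → count-zeros (column g i)) ⟩
  ∑[ i < suc d ] (columnGcd g i * N ^ m)
    ≡⟨ *-distribʳ-sum (N ^ m) (columnGcd g) ⟨
  ∑[ i < suc d ] columnGcd g i * N ^ m
    ≡⟨ cong (_* N ^ m) (sum-tabulate (columnGcd g)) ⟨
  sum (tabulate (columnGcd g)) * N ^ m ∎)
  where
  open ≤-Reasoning
  colZeros : Fin (suc d) → ℕ
  colZeros i = ∑ᵛ {N} m (λ a → 𝟙 (N ∣? dot a (column g i)))
  N^m<zeros : N ^ m < ∑ᵛ m (zeros g)
  N^m<zeros = subst (_< ∑ᵛ m (zeros g)) (∑ᵛ-one m)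
    -- Strictness comes from the zero vector: it has `suc d` zeros, more than one because `1 ≤ d`.
    (∑ᵛ-mono-< (thin⇒zeros C g gen thin) (replicate m 𝟘)
      (subst (1 <_) (sym (zeros-zero g)) (s≤s 1≤d)))
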